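{- Let $G$ and $H$ be finite simple graphs and let $f:V(G)\to V(H)$ be a weak graph homomorphism. Then $f$ induces a continuous map from $B(G)$ to $B(H)$ (both with the star topology); that is, the map $\Phi_f:B(G)\to B(H)$ given by $\Phi_f(u)=f(u)$ for every vertex $u\in V(G)$, and, for every edge $xy\in E(G)$, $\Phi_f(xy)=f(x)f(y)$ if $f(x)\neq f(y)$ and $\Phi_f(xy)=f(x)$ if $f(x)=f(y)$, is continuous.
   Context: Graphs are finite and simple: $G=(V(G),E(G))$ with $E(G)$ a set of 2-element subsets of $V(G)$, and $uv$ denotes the edge $\{u,v\}$. The bare representation $B(G)$ is the disjoint union $V(G)\sqcup E(G)$. The open star of $v\in V(G)$ is $S_G(v)=\{v\}\cup\{e\in E(G): e \text{ is incident to } v\}\subseteq B(G)$. The star topology on $B(G)$ is the topology generated by the sub-basis $\{S_G(v):v\in V(G)\}$. A weak graph homomorphism (egamorphism) from $G$ to $H$ is a map $f:V(G)\to V(H)$ such that for every $uv\in E(G)$, either $f(u)=f(v)$ or $f(u)f(v)\in E(H)$. -}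

module Defs where

open import Level using (0ℓ) renaming (suc to lsuc)
open import Data.Bool.Base using (Bool; T)
open import Data.Bool.Properties using (T-irrelevant)
open import Data.Fin.Base using (Fin; zero; suc)
open import Data.Fin.Properties using (_≟_)
open import Data.Fin.Subset as Subset
  using (Subset; inside; outside; ⁅_⁆; ∣_∣; _∈_)
open import Data.Fin.Subset.Properties
  using (∪-identityˡ; x∈⁅x⁆; x∈⁅y⁆⇒x≡y; x∈p∪q⁻; x∈p∪q⁺; ∪-comm)
open import Data.Nat.Base using (ℕ)
open import Data.Nat.Properties using (suc-injective)
open import Data.Product.Base using (∃; ∃₂; _,_; _×_)
open import Data.Sum.Base using (_⊎_; inj₁; inj₂; [_,_]; fromInj₂; map)
open import Data.Vec.Base using ([]; _∷_)
open import Function.Base using (id; _∘_)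
open import Relation.Binary.PropositionalEquality
  using (_≡_; _≢_; refl; sym; trans; cong; subst)
open import Relation.Nullary using (yes; no; contradiction)
open import Relation.Unary using (Pred; _≐_; _∩_; U; ⋃; _⊢_)

------------------------------------------------------------------------
-- Topologies

-- Unions are indexed by arbitrary small types; the empty set is the
-- union indexed by the empty type.  Subsets are predicates, so openness
-- is required to respect extensional equality.

record Topology (X : Set) : Set₂ where
  field
    Open      : Pred (Pred X 0ℓ) (lsuc 0ℓ)
    Open-resp : ∀ {A B} → A ≐ B → Open A → Open B
    Open-U    : Open U
    Open-∩    : ∀ {A B} → Open A → Open B → Open (A ∩ B)
    Open-⋃    : ∀ {I : Set} (A : I → Pred X 0ℓ) →
                (∀ i → Open (A i)) → Open (⋃ I A)

open Topology public using (Open)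

Continuous : ∀ {X Y : Set} → Topology X → Topology Y → (X → Y) → Set₁
Continuous 𝒳 𝒴 φ = ∀ A → Open 𝒴 A → Open 𝒳 (φ ⊢ A)

-- Being an inductive family, this is the least collection that contains
-- the sub-basis S and is closed under the axioms of a topology.

data GeneratedOpen {X J : Set} (S : J → Pred X 0ℓ) :
                   Pred (Pred X 0ℓ) (lsuc 0ℓ) where
  basic : ∀ j → GeneratedOpen S (S j)
  resp  : ∀ {A B} → A ≐ B → GeneratedOpen S A → GeneratedOpen S B
  whole : GeneratedOpen S U
  inter : ∀ {A B} → GeneratedOpen S A → GeneratedOpen S B →
          GeneratedOpen S (A ∩ B)
  union : ∀ {I : Set} (A : I → Pred X 0ℓ) →
          (∀ i → GeneratedOpen S (A i)) → GeneratedOpen S (⋃ I A)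

generatedBy : ∀ {X J : Set} → (J → Pred X 0ℓ) → Topology X
generatedBy S = record
  { Open      = GeneratedOpen S
  ; Open-resp = resp
  ; Open-U    = whole
  ; Open-∩    = inter
  ; Open-⋃    = union
  }

------------------------------------------------------------------------
-- Finite simple graphs

pair : ∀ {n} → Fin n → Fin n → Subset n
pair x y = ⁅ x ⁆ Subset.∪ ⁅ y ⁆

-- The edge set is a set of subsets of the vertex set Fin order, given by
-- its characteristic function.

record Graph : Set where
  field
    order     : ℕ
    isEdge    : Subset order → Bool
    edge-size : ∀ {p} → T (isEdge p) → ∣ p ∣ ≡ 2

V : Graph → Set
V G = Fin (Graph.order G)

record Edge (G : Graph) : Set where
  constructor edge
  field
    ends   : Subset (Graph.order G)
    ends∈E : T (Graph.isEdge G ends)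

open Edge public using (ends)

Adj : (G : Graph) → V G → V G → Set
Adj G x y = T (Graph.isEdge G (pair x y))

edgeOf : ∀ {G} (x y : V G) → Adj G x y → Edge G
edgeOf x y xy = edge (pair x y) xy

record WeakHom (G H : Graph) : Set where
  field
    fun  : V G → V H
    weak : ∀ u v → Adj G u v → fun u ≡ fun v ⊎ Adj H (fun u) (fun v)

------------------------------------------------------------------------
-- The bare representation and its star topology

B : Graph → Set
B G = V G ⊎ Edge G

Star : (G : Graph) → V G → Pred (B G) 0ℓ
Star G v = [ (λ u → u ≡ v) , (λ e → v ∈ ends e) ]

starTopology : (G : Graph) → Topology (B G)
starTopology G = generatedBy (Star G)

------------------------------------------------------------------------
-- Endpoints of an edge

size-0 : ∀ {n} (p : Subset n) → ∣ p ∣ ≡ 0 → p ≡ Subset.⊥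
size-0 []            _  = refl
size-0 (outside ∷ p) eq = cong (outside ∷_) (size-0 p eq)

size-1 : ∀ {n} (p : Subset n) → ∣ p ∣ ≡ 1 → ∃ λ x → p ≡ ⁅ x ⁆
size-1 (inside ∷ p) eq =
  zero , cong (inside ∷_) (size-0 p (suc-injective eq))
size-1 (outside ∷ p) eq with x , p≡ ← size-1 p eq =
  suc x , cong (outside ∷_) p≡

size-2 : ∀ {n} (p : Subset n) → ∣ p ∣ ≡ 2 → ∃₂ λ x y → p ≡ pair x y
size-2 (inside ∷ p) eq with y , p≡ ← size-1 p (suc-injective eq) =
  zero , suc y ,
  cong (inside ∷_) (trans p≡ (sym (∪-identityˡ ⁅ y ⁆)))
size-2 (outside ∷ p) eq with x , y , p≡ ← size-2 p eq =
  suc x , suc y , cong (outside ∷_) p≡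

endpoints : ∀ {G} (e : Edge G) → ∃₂ λ x y → ends e ≡ pair x y
endpoints {G} (edge p p∈E) = size-2 p (Graph.edge-size G p∈E)

------------------------------------------------------------------------
-- The induced map

module _ {G H : Graph} (f : WeakHom G H) where
  open WeakHom f

  imageOfEdge : (x y : V G) → Adj G x y → B H
  imageOfEdge x y xy with fun x ≟ fun y
  ... | yes _   = inj₁ (fun x)
  ... | no  x≢y = inj₂ (edgeOf (fun x) (fun y)
                    (fromInj₂ (λ x≡y → contradiction x≡y x≢y) (weak x y xy)))

  -- Edges are unordered, so Φ evaluates imageOfEdge at some ordering of
  -- the endpoints; Φ-edge shows that the ordering is immaterial.
  Φ : B G → B H
  Φ (inj₁ u) = inj₁ (fun u)
  Φ (inj₂ e@(edge _ p∈E)) with x , y , p≡ ← endpoints e =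
    imageOfEdge x y (subst (T ∘ Graph.isEdge G) p≡ p∈E)

------------------------------------------------------------------------
-- Φ satisfies its defining equations

edge-≡ : ∀ {G} {e e′ : Edge G} → ends e ≡ ends e′ → e ≡ e′
edge-≡ {e = edge p a} {edge .p b} refl = cong (edge p) (T-irrelevant a b)

∈-pair⁻ : ∀ {n} {z : Fin n} x y → z ∈ pair x y → z ≡ x ⊎ z ≡ y
∈-pair⁻ x y = map (x∈⁅y⁆⇒x≡y x) (x∈⁅y⁆⇒x≡y y) ∘ x∈p∪q⁻ ⁅ x ⁆ ⁅ y ⁆

pair-≡ : ∀ {n} {x y x′ y′ : Fin n} → pair x y ≡ pair x′ y′ →
         (x ≡ x′ × y ≡ y′) ⊎ (x ≡ y′ × y ≡ x′)
pair-≡ {x = x} {y} {x′} {y′} eq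
  with ∈-pair⁻ x′ y′ (subst (x ∈_) eq (x∈p∪q⁺ (inj₁ (x∈⁅x⁆ x))))
     | ∈-pair⁻ x′ y′ (subst (y ∈_) eq (x∈p∪q⁺ (inj₂ (x∈⁅x⁆ y))))
... | inj₁ x≡x′ | inj₂ y≡y′ = inj₁ (x≡x′ , y≡y′)
... | inj₂ x≡y′ | inj₁ y≡x′ = inj₂ (x≡y′ , y≡x′)
... | inj₁ refl | inj₁ refl =
  [ (λ y′≡x → inj₁ (refl , sym y′≡x)) , (λ y′≡x → inj₁ (refl , sym y′≡x)) ]
  (∈-pair⁻ x y (subst (y′ ∈_) (sym eq) (x∈p∪q⁺ (inj₂ (x∈⁅x⁆ y′)))))
... | inj₂ refl | inj₂ refl =
  [ (λ x′≡x → inj₁ (sym x′≡x , refl)) , (λ x′≡x → inj₁ (sym x′≡x , refl)) ]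
  (∈-pair⁻ x y (subst (x′ ∈_) (sym eq) (x∈p∪q⁺ (inj₁ (x∈⁅x⁆ x′)))))

module _ {G H : Graph} (f : WeakHom G H) where
  open WeakHom f

  imageOfEdge-≢ : ∀ x y xy → fun x ≢ fun y →
                  (fxfy : Adj H (fun x) (fun y)) →
                  imageOfEdge f x y xy ≡ inj₂ (edgeOf (fun x) (fun y) fxfy)
  imageOfEdge-≢ x y xy x≢y fxfy with fun x ≟ fun y
  ... | yes x≡y = contradiction x≡y x≢y
  ... | no  _   = cong inj₂ (edge-≡ refl)

  imageOfEdge-≡ : ∀ x y xy → fun x ≡ fun y →
                  imageOfEdge f x y xy ≡ inj₁ (fun x)
  imageOfEdge-≡ x y xy x≡y with fun x ≟ fun y
  ... | yes _   = refl
  ... | no  x≢y = contradiction x≡y x≢y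

  imageOfEdge-comm : ∀ x y xy yx → imageOfEdge f x y xy ≡ imageOfEdge f y x yx
  imageOfEdge-comm x y xy yx with fun x ≟ fun y | fun y ≟ fun x
  ... | yes x≡y | yes _   = cong inj₁ x≡y
  ... | yes x≡y | no  y≢x = contradiction (sym x≡y) y≢x
  ... | no  x≢y | yes y≡x = contradiction (sym y≡x) x≢y
  ... | no  _   | no  _   = cong inj₂ (edge-≡ (∪-comm ⁅ fun x ⁆ ⁅ fun y ⁆))

  Φ-edge : ∀ x y xy → Φ f (inj₂ (edgeOf x y xy)) ≡ imageOfEdge f x y xy
  Φ-edge x y xy with endpoints (edgeOf {G} x y xy)
  ... | x′ , y′ , p≡ with pair-≡ {x = x} {y} p≡
  ...   | inj₁ (refl , refl) = cong (imageOfEdge f x y) (T-irrelevant _ _)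
  ...   | inj₂ (refl , refl) = imageOfEdge-comm y x _ _

  Φ-edge-≢ : ∀ x y xy → fun x ≢ fun y → (fxfy : Adj H (fun x) (fun y)) →
             Φ f (inj₂ (edgeOf x y xy)) ≡ inj₂ (edgeOf (fun x) (fun y) fxfy)
  Φ-edge-≢ x y xy x≢y fxfy =
    trans (Φ-edge x y xy) (imageOfEdge-≢ x y xy x≢y fxfy)

  Φ-edge-≡ : ∀ x y xy → fun x ≡ fun y →
             Φ f (inj₂ (edgeOf x y xy)) ≡ inj₁ (fun x)
  Φ-edge-≡ x y xy x≡y = trans (Φ-edge x y xy) (imageOfEdge-≡ x y xy x≡y)

{-# OPTIONS --safe #-}

-- An edge is sent to the edge joining the images of its endpoints, or to
-- their common image.  Hence the preimage of the star of v is the union of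
-- the stars of the vertices in the fibre over v, and continuity may be tested
-- on a sub-basis.
module Submission where

open import Defs

open import Data.Fin.Base using (Fin)
open import Data.Fin.Properties using (_≟_)
open import Data.Fin.Subset using (_∈_)
open import Data.Fin.Subset.Properties using (x∈⁅x⁆; x∈p∪q⁺)
open import Data.Product.Base using (∃; _,_; _×_)
open import Data.Sum.Base using (inj₁; inj₂)
open import Level using (0ℓ)
open import Relation.Binary.PropositionalEquality using (_≡_; refl; sym)
open import Relation.Nullary using (yes; no)
open import Relation.Unary using (Pred; _≐_; ⋃; _⊢_)

-- By induction on how the open set is generated: taking preimages commutes definitionally with `U`,
-- `∩` and `⋃`, so each constructor is answered by the matching axiom of `𝒳`.
continuous-generatedBy :
  ∀ {X Y J : Set} (𝒳 : Topology X) (S : J → Pred Y 0ℓ) {φ : X → Y} →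
  (∀ j → Open 𝒳 (φ ⊢ S j)) → Continuous 𝒳 (generatedBy S) φ
continuous-generatedBy 𝒳 S {φ} open-S = preimage
  where
  open Topology 𝒳 using (Open-resp; Open-U; Open-∩; Open-⋃)

  preimage : ∀ A → GeneratedOpen S A → Open 𝒳 (φ ⊢ A)
  preimage _ (basic j)            = open-S j
  preimage _ (resp (A⊆B , B⊆A) o) = Open-resp (A⊆B , B⊆A) (preimage _ o)
  preimage _ whole                = Open-U
  preimage _ (inter o o′)         = Open-∩ (preimage _ o) (preimage _ o′)
  preimage _ (union A os)         =
    Open-⋃ (λ i → φ ⊢ A i) (λ i → preimage _ (os i))

x∈pair : ∀ {n} (x y : Fin n) → x ∈ pair x y
x∈pair x y = x∈p∪q⁺ (inj₁ (x∈⁅x⁆ x))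

y∈pair : ∀ {n} (x y : Fin n) → y ∈ pair x y
y∈pair x y = x∈p∪q⁺ (inj₂ (x∈⁅x⁆ y))

module _ {G H : Graph} (f : WeakHom G H) where
  open WeakHom f

  -- Serves as the index type of a union of stars; for `v` outside the image of `fun` it is empty,
  -- and so is the union.
  Fibre : V H → Set
  Fibre v = ∃ λ u → fun u ≡ v

  imageOfEdge∈Star⁻ : ∀ {v} x y xy → Star H v (imageOfEdge f x y xy) →
                      ∃ λ u → fun u ≡ v × u ∈ pair x y
  imageOfEdge∈Star⁻ x y xy s with fun x ≟ fun y
  -- A collapsed edge is sent to `fun x`, so `s` itself says that `x` lies over `v`.
  ... | yes _ = x , s , x∈pair x y
  ... | no  _ with ∈-pair⁻ (fun x) (fun y) s
  ...   | inj₁ v≡fx = x , sym v≡fx , x∈pair x y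
  ...   | inj₂ v≡fy = y , sym v≡fy , y∈pair x y

  imageOfEdge∈Star⁺ : ∀ {u} x y xy → u ∈ pair x y →
                      Star H (fun u) (imageOfEdge f x y xy)
  imageOfEdge∈Star⁺ x y xy u∈ with fun x ≟ fun y | ∈-pair⁻ x y u∈
  ... | yes _   | inj₁ refl = refl
  -- Here `u` is `y` but the image is `fun x`, so membership in the star is the collapse equation.
  ... | yes x≡y | inj₂ refl = x≡y
  ... | no  _   | inj₁ refl = x∈pair (fun x) (fun y)
  ... | no  _   | inj₂ refl = y∈pair (fun x) (fun y)

  preimage-Star : ∀ v → ⋃ (Fibre v) (λ (u , _) → Star G u) ≐ (Φ f ⊢ Star H v)
  preimage-Star v = (λ {b} → to b) , (λ {b} → from b)
    where
    to : ∀ b → ⋃ (Fibre v) (λ (u , _) → Star G u) b → Star H v (Φ f b)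
    to (inj₁ u) ((_ , fu≡v) , refl) = fu≡v
    -- Abstracting the same `endpoints e` that `Φ` inspects reduces `Φ f (inj₂ e)` to `imageOfEdge`
    -- at the ordering chosen there; `refl` then removes the `subst`.
    to (inj₂ e@(edge _ _)) ((u , refl) , u∈e) with endpoints e
    ... | x , y , refl = imageOfEdge∈Star⁺ x y _ u∈e

    from : ∀ b → Star H v (Φ f b) → ⋃ (Fibre v) (λ (u , _) → Star G u) b
    from (inj₁ u) fu≡v = (u , fu≡v) , refl
    from (inj₂ e@(edge _ _)) s with endpoints e
    ... | x , y , refl with u , fu≡v , u∈ ← imageOfEdge∈Star⁻ x y _ s =
      (u , fu≡v) , u∈

theorem4p4 : (G H : Graph) (f : WeakHom G H) →
    Continuous (starTopology G) (starTopology H) (Φ f)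
theorem4p4 G H f = continuous-generatedBy (starTopology G) (Star H) λ v →
  resp (preimage-Star f v) (union _ λ (u , _) → basic u)
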